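{- Let $G=(V,E,\omega)$ be a finite directed non-negatively weighted graph, $r\in V$ a root and $k\ge 1$ an integer. Algorithm Exh-S-kSSP (described in the context), run on input $(G,r,k)$, computes all simple paths from $r$ to any other vertex; that is, every simple path from $r$ to any vertex of $V\setminus\{r\}$ is dequeued from the priority queue at some point of the execution.
   Context: $G=(V,E,\omega)$ is a finite directed graph, $E\subseteq V\times V$, with non-negative real edge weights $\omega$; $N^+(v)=\{u:(v,u)\in E\}$. A path from $s$ to $t$ is a vertex sequence $P=(s=v_1,\dots,v_\eta=t)$, $\eta\ge 1$, with $(v_i,v_{i+1})\in E$ for all $i<\eta$; $V(P)$ is its vertex set; it is simple if it has no repeated vertex; its weight is $\omega(P)=\sum_{i=1}^{\eta-1}\omega(v_i,v_{i+1})$. For a path $\Pi$ ending at $v$ and an edge $(v,u)$, $\Pi\oplus(u)$ is $\Pi$ extended by $u$. Algorithm Exh-S-kSSP. Maintain a list $T_v$ for each $v\in V$ (initially empty) and a min-priority queue $PQ$ of paths keyed by weight, initially containing only the trivial path $(r)$ with key $0$. While $PQ\ne\emptyset$: remove (dequeue) from $PQ$ a path $\Pi=(r,\dots,v)$ of minimum weight; for each $u\in N^+(v)\setminus V(\Pi)$ insert $\Pi\oplus(u)$ into $PQ$ with key $\omega(\Pi)+\omega(v,u)$; if $|T_v|<k$, add $\Pi$ to $T_v$. -}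

module Defs where

open import Data.Fin using (Fin)
open import Data.Fin.Properties using (_≟_)
import Data.List.Membership.DecPropositional as DecMembership
open import Data.List using (List; []; _∷_; [_]; _++_; _∷ʳ_; length; mapMaybe; allFin)
open import Data.List.Relation.Binary.Permutation.Propositional using (_↭_)
open import Data.List.Relation.Unary.All using (All)
open import Data.List.Relation.Unary.Unique.Propositional using (Unique)
open import Data.Maybe using (Maybe; just; nothing)
open import Data.Nat as ℕ using (ℕ; suc; _⊔_)
import Data.Nat.Properties as ℕ
open import Data.Product using (∃; ∃-syntax; _×_; _,_; proj₁)
open import Data.Rational as ℚ using (ℚ; 0ℚ; ½; Positive)
import Data.Rational.Properties as ℚ
open import Data.Rational.Solver using (module +-*-Solver)
open import Level using (0ℓ)
open import Relation.Binary.Core using (Rel)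
open import Relation.Binary.Definitions using (Decidable)
open import Relation.Binary.PropositionalEquality using (_≡_; refl; cong)
open import Relation.Nullary using (yes; no)

------------------------------------------------------------------------
-- Real numbers

-- Cauchy sequences of rationals.  Distinct sequences may denote the same
-- real; weights and keys are only ever added and compared, and both
-- operations respect equality of limits.

record ℝ : Set where
  field
    seq    : ℕ → ℚ
    cauchy : ∀ ε → .{{Positive ε}} →
             ∃[ N ] (∀ m n → N ℕ.≤ m → N ℕ.≤ n → ℚ.∣ seq m ℚ.- seq n ∣ ℚ.< ε)

open ℝ public

infix  4 _≤_
infixl 6 _+_

_≤_ : Rel ℝ 0ℓ
x ≤ y = ∀ ε → .{{Positive ε}} → ∃[ N ] (∀ n → N ℕ.≤ n → seq x n ℚ.≤ seq y n ℚ.+ ε)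

0ℝ : ℝ
0ℝ = record
  { seq    = λ _ → 0ℚ
  ; cauchy = λ ε → 0 , λ _ _ _ _ → ℚ.positive⁻¹ ε
  }

_+_ : ℝ → ℝ → ℝ
x + y = record { seq = s ; cauchy = s-cauchy }
  where
  s : ℕ → ℚ
  s n = seq x n ℚ.+ seq y n

  regroup : ∀ a b c d → (a ℚ.+ b) ℚ.- (c ℚ.+ d) ≡ (a ℚ.- c) ℚ.+ (b ℚ.- d)
  regroup = solve 4 (λ a b c d → (a :+ b) :- (c :+ d) := (a :- c) :+ (b :- d)) refl
    where open +-*-Solver

  halves : ∀ ε → ½ ℚ.* ε ℚ.+ ½ ℚ.* ε ≡ ε
  halves = solve 1 (λ ε → con ½ :* ε :+ con ½ :* ε := ε) refl
    where open +-*-Solver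

  s-cauchy : ∀ ε → .{{Positive ε}} →
             ∃[ N ] (∀ m n → N ℕ.≤ m → N ℕ.≤ n → ℚ.∣ s m ℚ.- s n ∣ ℚ.< ε)
  s-cauchy ε
    with cauchy x (½ ℚ.* ε) {{ℚ.pos*pos⇒pos ½ ε}} | cauchy y (½ ℚ.* ε) {{ℚ.pos*pos⇒pos ½ ε}}
  ... | M , close-x | N , close-y = M ⊔ N , close
    where
    close : ∀ m n → M ⊔ N ℕ.≤ m → M ⊔ N ℕ.≤ n → ℚ.∣ s m ℚ.- s n ∣ ℚ.< ε
    close m n p q = begin-strict
      ℚ.∣ s m ℚ.- s n ∣
        ≡⟨ cong ℚ.∣_∣ (regroup (seq x m) (seq y m) (seq x n) (seq y n)) ⟩
      ℚ.∣ (seq x m ℚ.- seq x n) ℚ.+ (seq y m ℚ.- seq y n) ∣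
        ≤⟨ ℚ.∣p+q∣≤∣p∣+∣q∣ (seq x m ℚ.- seq x n) (seq y m ℚ.- seq y n) ⟩
      ℚ.∣ seq x m ℚ.- seq x n ∣ ℚ.+ ℚ.∣ seq y m ℚ.- seq y n ∣
        <⟨ ℚ.+-mono-< (close-x m n (ℕ.m⊔n≤o⇒m≤o M N p) (ℕ.m⊔n≤o⇒m≤o M N q))
                      (close-y m n (ℕ.m⊔n≤o⇒n≤o M N p) (ℕ.m⊔n≤o⇒n≤o M N q)) ⟩
      ½ ℚ.* ε ℚ.+ ½ ℚ.* ε
        ≡⟨ halves ε ⟩
      ε ∎
      where open ℚ.≤-Reasoning

------------------------------------------------------------------------
-- Weighted digraphs and paths

-- The edge argument of ω is irrelevant, so that an edge is nothing more
-- than a pair of vertices and parallel edges do not arise.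

record Graph (n : ℕ) : Set₁ where
  infix 4 _⟶_ _⟶?_
  field
    _⟶_      : Rel (Fin n) 0ℓ
    _⟶?_     : Decidable _⟶_
    ω        : ∀ v u → .(v ⟶ u) → ℝ
    ω-nonNeg : ∀ v u → .(e : v ⟶ u) → 0ℝ ≤ ω v u e

module _ {n : ℕ} (G : Graph n) where
  open Graph G
  open DecMembership (_≟_ {n}) using (_∈?_)

  -- By irrelevance, equality of paths is equality of vertex sequences.

  data Path (s : Fin n) : Fin n → Set where
    trivial : Path s s
    extend  : ∀ {v} → Path s v → (u : Fin n) → .(v ⟶ u) → Path s u

  vertices : ∀ {s t} → Path s t → List (Fin n)
  vertices {s} trivial    = [ s ]
  vertices (extend Π u _) = vertices Π ∷ʳ u

  Simple : ∀ {s t} → Path s t → Set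
  Simple Π = Unique (vertices Π)

  weight : ∀ {s t} → Path s t → ℝ
  weight trivial            = 0ℝ
  weight (extend {v} Π u e) = weight Π + ω v u e

------------------------------------------------------------------------
-- Algorithm Exh-S-kSSP

  module _ (r : Fin n) where

    PathFrom : Set
    PathFrom = ∃[ v ] Path r v

    -- The lists PQ are read up to permutation.

    record State : Set where
      constructor ⟨_,_⟩
      field
        PQ : List (ℝ × PathFrom)
        T  : ∀ v → List (Path r v)

    initial : State
    initial = ⟨ [ 0ℝ , r , trivial ] , (λ _ → []) ⟩

    -- One entry Π ⊕ (u) for each u ∈ N⁺(v) ∖ V(Π).

    insertions : ∀ {v} → Path r v → List (ℝ × PathFrom)
    insertions {v} Π = mapMaybe insertion (allFin n)
      where
      insertion : Fin n → Maybe (ℝ × PathFrom)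
      insertion u with v ⟶? u | u ∈? vertices Π
      ... | yes e | no  _ = just (weight Π + ω v u e , u , extend Π u e)
      ... | yes _ | yes _ = nothing
      ... | no  _ | _     = nothing

    record-path : ℕ → ∀ {v} → Path r v → (∀ w → List (Path r w)) → ∀ w → List (Path r w)
    record-path k {v} Π T w with v ≟ w | length (T w) ℕ.<? k
    ... | yes refl | yes _ = T w ∷ʳ Π
    ... | yes _    | no  _ = T w
    ... | no  _    | _     = T w

    -- The label is the path dequeued, if any.  Ties between paths of
    -- minimum weight may be broken arbitrarily; once the queue is empty
    -- the state no longer changes.

    data Step (k : ℕ) : State → Maybe PathFrom → State → Set where
      dequeue : ∀ {PQ T κ v Π rest} →
                PQ ↭ (κ , v , Π) ∷ rest →
                All (λ entry → κ ≤ proj₁ entry) rest →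
                Step k ⟨ PQ , T ⟩ (just (v , Π))
                       ⟨ insertions Π ++ rest , record-path k Π T ⟩
      halted  : ∀ {T} → Step k ⟨ [] , T ⟩ nothing ⟨ [] , T ⟩

    record Execution (k : ℕ) : Set where
      field
        state    : ℕ → State
        dequeued : ℕ → Maybe PathFrom
        start    : state 0 ≡ initial
        step     : ∀ i → Step k (state i) (dequeued i) (state (suc i))

{-# OPTIONS --safe #-}

-- A path of the search has at most n one-vertex extensions by an unvisited
-- vertex, and each of these has fewer unvisited vertices left.  Hence, if a
-- queued path with d unvisited vertices is charged (n + 1)^d, every dequeuing
-- lowers the total charge of the queue, so that the queue is exhausted and
-- every path ever inserted is eventually dequeued.  A simple path is inserted
-- when its longest proper prefix is dequeued, and induction on the path
-- concludes.

module Submission where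

open import Defs
open import Data.Empty using (⊥-elim; ⊥-elim-irr)
open import Data.Fin using (Fin)
open import Data.Fin.Properties using (_≟_)
open import Data.Fin.Subset using (Subset; ⊤; ∣_∣; _-_) renaming (_∈_ to _∈ˢ_)
open import Data.Fin.Subset.Properties using (∈⊤; x∈p∧x≢y⇒x∈p-y; x∈p⇒∣p-x∣<∣p∣)
open import Data.List using (List; []; _∷_; _++_; _∷ʳ_; length; map; mapMaybe; allFin)
open import Data.List.Membership.Propositional using (_∉_; lose)
open import Data.List.Membership.Propositional.Properties
  using (∈-++⁺ˡ; ∈-++⁺ʳ; ∈-allFin)
import Data.List.Membership.DecPropositional as DecMembership
open import Data.List.Properties using (length-mapMaybe; length-tabulate; map-++)
open import Data.List.Relation.Binary.Permutation.Propositional.Properties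
  using (Any-resp-↭) renaming (map⁺ to ↭-map⁺)
open import Data.List.Relation.Unary.All as All using (All; []; _∷_)
import Data.List.Relation.Unary.All.Properties as All
open import Data.List.Relation.Unary.AllPairs using ([]; _∷_)
open import Data.List.Relation.Unary.Any as Any using (Any; here; there)
import Data.List.Relation.Unary.Any.Properties as Any
open import Data.List.Relation.Unary.Unique.Propositional using (Unique)
open import Data.Maybe using (Maybe; just)
import Data.Maybe.Relation.Unary.All as Maybe
import Data.Maybe.Relation.Unary.Any as MaybeAny
open import Data.Nat as ℕ using (ℕ; zero; suc; _^_; s≤s; s≤s⁻¹; z≤n)
open import Data.Nat.Induction using (Acc; acc; <-wellFounded)
open import Data.Nat.ListAction using (sum)
open import Data.Nat.ListAction.Properties using (sum-++; sum-↭)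
import Data.Nat.Properties as ℕ
open import Data.Product using (∃; ∃-syntax; _×_; _,_; proj₁; proj₂)
open import Data.Sum using (_⊎_; inj₁; inj₂)
open import Function using (_∘_)
open import Relation.Binary.PropositionalEquality
  using (_≡_; _≢_; refl; sym; cong; subst)
open import Relation.Nullary using (yes; no)

Unique-∷ʳ⁻ : ∀ {A : Set} {xs : List A} {x} → Unique (xs ∷ʳ x) → Unique xs × x ∉ xs
Unique-∷ʳ⁻ {xs = []}     _            = [] , λ ()
Unique-∷ʳ⁻ {xs = y ∷ xs} (y∉ ∷ uniq) with Unique-∷ʳ⁻ uniq | All.∷ʳ⁻ y∉
... | uniq-xs , x∉xs | y∉xs , y≢x = y∉xs ∷ uniq-xs , λ where
  (here refl)  → y≢x refl
  (there x∈xs) → x∉xs x∈xs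

sum-map-≤ : ∀ {A : Set} (f : A → ℕ) {c xs} →
            All (λ x → f x ℕ.≤ c) xs → sum (map f xs) ℕ.≤ length xs ℕ.* c
sum-map-≤ f []         = z≤n
sum-map-≤ f (fx≤ ∷ fs) = ℕ.+-mono-≤ fx≤ (sum-map-≤ f fs)

sum-^-< : ∀ {A : Set} (f : A → ℕ) {n} d {xs} → length xs ℕ.≤ n →
          All (λ x → f x ℕ.< d) xs → sum (map (λ x → suc n ^ f x) xs) ℕ.< suc n ^ d
sum-^-< f zero    _ [] = s≤s z≤n
sum-^-< f {n} (suc d) {xs} len≤n fs = begin-strict
  sum (map (λ x → suc n ^ f x) xs) ≤⟨ sum-map-≤ _ (All.map (ℕ.^-monoʳ-≤ (suc n) ∘ s≤s⁻¹) fs) ⟩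
  length xs ℕ.* suc n ^ d          ≤⟨ ℕ.*-monoˡ-≤ (suc n ^ d) len≤n ⟩
  n ℕ.* suc n ^ d                  <⟨ ℕ.+-monoˡ-≤ (n ℕ.* suc n ^ d) (ℕ.m^n>0 (suc n) d) ⟩
  suc n ^ suc d                    ∎
  where open ℕ.≤-Reasoning

module _ {n : ℕ} (G : Graph n) where
  open Graph G
  open DecMembership (_≟_ {n}) using (_∈?_)

  unvisited : ∀ {s t} → Path G s t → Subset n
  unvisited {s} trivial        = ⊤ - s
  unvisited     (extend Π u _) = unvisited Π - u

  ∉vertices⇒∈unvisited : ∀ {s t u} (Π : Path G s t) →
                         u ∉ vertices G Π → u ∈ˢ unvisited Π
  ∉vertices⇒∈unvisited trivial        u∉ = x∈p∧x≢y⇒x∈p-y ∈⊤ (u∉ ∘ here)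
  ∉vertices⇒∈unvisited (extend Π w _) u∉ = x∈p∧x≢y⇒x∈p-y
    (∉vertices⇒∈unvisited Π (u∉ ∘ ∈-++⁺ˡ))
    (u∉ ∘ ∈-++⁺ʳ (vertices G Π) ∘ here)

  module _ (r : Fin n) where

    Entry : Set
    Entry = ℝ × PathFrom G r

    #unvisited : Entry → ℕ
    #unvisited (_ , _ , Π) = ∣ unvisited Π ∣

    charge : List Entry → ℕ
    charge es = sum (map (λ e → suc n ^ #unvisited e) es)

    -- Unification names the local function of the definition of insertions.
    insertion : ∀ {v} (Π : Path G r v) →
                ∃ λ (f : Fin n → Maybe Entry) → insertions G r Π ≡ mapMaybe f (allFin n)
    insertion Π = _ , refl

    insertion-unvisited : ∀ {v} (Π : Path G r v) u →
      Maybe.All (λ e → #unvisited e ℕ.< ∣ unvisited Π ∣) (proj₁ (insertion Π) u)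
    insertion-unvisited {v} Π u with v ⟶? u | u ∈? vertices G Π
    ... | yes _ | no u∉ = Maybe.just (x∈p⇒∣p-x∣<∣p∣ (∉vertices⇒∈unvisited Π u∉))
    ... | yes _ | yes _ = Maybe.nothing
    ... | no  _ | yes _ = Maybe.nothing
    ... | no  _ | no  _ = Maybe.nothing

    insertion-extend : ∀ {v} (Π : Path G r v) u .(e : v ⟶ u) → u ∉ vertices G Π →
      MaybeAny.Any (((u , extend Π u e) ≡_) ∘ proj₂) (proj₁ (insertion Π) u)
    insertion-extend {v} Π u e u∉ with v ⟶? u | u ∈? vertices G Π
    ... | yes _  | no _   = MaybeAny.just refl
    ... | _      | yes u∈ = ⊥-elim (u∉ u∈)
    ... | no ¬e  | no _   = ⊥-elim-irr (¬e e)

    charge-insertions : ∀ {v} (Π : Path G r v) →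
                        charge (insertions G r Π) ℕ.< suc n ^ ∣ unvisited Π ∣
    charge-insertions Π = sum-^-< #unvisited ∣ unvisited Π ∣
      (ℕ.≤-trans (length-mapMaybe _ (allFin n)) (ℕ.≤-reflexive (length-tabulate _)))
      (All.mapMaybe⁺ (All.map⁺ (All.universal (insertion-unvisited Π) (allFin n))))

    Queued : PathFrom G r → List Entry → Set
    Queued P = Any ((P ≡_) ∘ proj₂)

    extend-queued : ∀ {v} (Π : Path G r v) u .(e : v ⟶ u) → u ∉ vertices G Π →
                    Queued (u , extend Π u e) (insertions G r Π)
    extend-queued Π u e u∉ = Any.mapMaybe⁺ _ (allFin n)
      (Any.map⁺ (lose (∈-allFin u) (insertion-extend Π u e u∉)))

    step-queued : ∀ {k s m s′ P} → Step G r k s m s′ → Queued P (State.PQ s) →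
                  m ≡ just P ⊎
                  (Queued P (State.PQ s′) × charge (State.PQ s′) ℕ.< charge (State.PQ s))
    step-queued (dequeue {PQ} {κ = κ} {v} {Π} {rest} PQ↭ _) q with Any-resp-↭ PQ↭ q
    ... | here refl = inj₁ refl
    ... | there q′  = inj₂ (Any.++⁺ʳ (insertions G r Π) q′ , (begin-strict
      charge (insertions G r Π ++ rest)            ≡⟨ cong sum (map-++ _ (insertions G r Π) rest) ⟩
      sum (map _ (insertions G r Π) ++ map _ rest) ≡⟨ sum-++ (map _ (insertions G r Π)) (map _ rest) ⟩
      charge (insertions G r Π) ℕ.+ charge rest    <⟨ ℕ.+-monoˡ-< (charge rest) (charge-insertions Π) ⟩
      charge ((κ , v , Π) ∷ rest)                  ≡⟨ sum-↭ (↭-map⁺ _ PQ↭) ⟨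
      charge PQ                                    ∎))
      where open ℕ.≤-Reasoning
    step-queued halted ()

    module _ {k : ℕ} (exec : Execution G r k) where
      open Execution exec

      Dequeued : PathFrom G r → Set
      Dequeued P = ∃[ i ] dequeued i ≡ just P

      queued⇒dequeued : ∀ {P} i → Queued P (State.PQ (state i)) → Dequeued P
      queued⇒dequeued i q = go i q (<-wellFounded _)
        where
        go : ∀ {P} i → Queued P (State.PQ (state i)) →
             Acc ℕ._<_ (charge (State.PQ (state i))) → Dequeued P
        go i q (acc rs) with step-queued (step i) q
        ... | inj₁ eq        = i , eq
        ... | inj₂ (q′ , c<) = go (suc i) q′ (rs c<)

      dequeued⇒extend-queued : ∀ {s m s′ v u} {Π : Path G r v} .(e : v ⟶ u) →
        u ∉ vertices G Π → Step G r k s m s′ → m ≡ just (v , Π) →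
        Queued (u , extend Π u e) (State.PQ s′)
      dequeued⇒extend-queued {Π = Π} e u∉ (dequeue _ _) refl =
        Any.++⁺ˡ (extend-queued Π _ e u∉)

      simple⇒dequeued : ∀ {v} (P : Path G r v) → Simple G P → Dequeued (v , P)
      simple⇒dequeued trivial _ =
        queued⇒dequeued 0 (subst (Queued _ ∘ State.PQ) (sym start) (here refl))
      simple⇒dequeued (extend Π u e) simple with Unique-∷ʳ⁻ simple
      ... | simple-Π , u∉ with simple⇒dequeued Π simple-Π
      ...   | i , eq = queued⇒dequeued (suc i) (dequeued⇒extend-queued e u∉ (step i) eq)

lemma1 : ∀ {n : ℕ} (G : Graph n) (r : Fin n) (k : ℕ) → 1 ℕ.≤ k →
    (exec : Execution G r k) →
    ∀ {v : Fin n} → v ≢ r → (P : Path G r v) → Simple G P →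
    ∃[ i ] (Execution.dequeued exec i ≡ just (v , P))
lemma1 G r k _ exec _ P simple = simple⇒dequeued G r exec P simple
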